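{- Let $\mathcal{I}=\bigl(([s_i,e_i))_{i\in[n]},q,\mathcal{S}\bigr)$ be an instance of the extended version with an arbitrary set $\mathcal{S}$ of non-overlapping schedules. If there exists a balanced feasible assignment for $\mathcal{I}$, then there exists a balanced feasible assignment for $\mathcal{I}$ that is periodic. Moreover, in such a case, the periodic balanced feasible assignment can be chosen with period at most $q^2\,q!$.
   Context: Tasks: $n$ intervals $[s_i,e_i)\subseteq(-1,1)$, $i\in[n]$, with $e_i\in(0,1]$, $e_i-s_i\le 1$; the $r$th occurrence ($r\in\mathbb{Z}_{>0}$) of task $i$ occupies $[s_i+r,e_i+r)$; $q$ is a positive integer and workers are identified with $[q]$. Let $U(\mathcal{I})=\{i\in[n]: s_i\le 0\}$. A schedule is a pair $(T,W)$ with $T\subseteq[n]$ and either $W=\varnothing$ or $W=\{i\}$ with $i\in U(\mathcal{I})$. It is non-overlapping if for all $i'\in T$: $[s_{i'},e_{i'})\cap[s_{i''},e_{i''})=\varnothing$ for all $i''\in T\setminus\{i'\}$, and $[s_{i'},e_{i'})\cap[s_i+1,e_i+1)=\varnothing$ for all $i\in W$. An instance of the extended version is a triple $\bigl(([s_i,e_i))_{i\in[n]},q,\mathcal{S}\bigr)$ where $\mathcal{S}$ is a set of non-overlapping schedules. An assignment is a map $f:[n]\times\mathbb{Z}_{>0}\to[q]$. For a worker $j$ and a week $r\in\mathbb{Z}_{>0}$ (the time interval $(r,r+1]$), the schedule induced by $f$ is $(T,W)$ with $T=\{i\in[n]: f(i,r)=j\}$ (tasks whose occurrence finishing during week $r$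 is performed by $j$) and $W=\{i\in U(\mathcal{I}): f(i,r+1)=j\}$ (task starting during week $r$ and finishing during week $r+1$ performed by $j$). An assignment is feasible if all the schedules it induces belong to $\mathcal{S}$. It is balanced if for every $i\in[n]$ and $j\in[q]$ the limit $\lim_{t\to\infty}\frac1t|\{r\in[t]:f(i,r)=j\}|$ exists and equals $1/q$. It is periodic with period $h\in\mathbb{Z}_{>0}$ if $f(i,r)=f(i,r+h)$ for all $i,r$.
   Formalization: The interval endpoints s_i and e_i are taken to be rational numbers instead of real numbers; everything else is as stated. -}

module Defs where

open import Data.Nat as ℕ using (ℕ; zero; suc; NonZero)
open import Data.Fin using (Fin)
open import Data.Fin.Subset using (Subset; _∈_; _⊆_; ∣_∣; inside; outside)
open import Data.Vec using (tabulate)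
open import Data.Rational as ℚ using (ℚ; 0ℚ; 1ℚ; _≤_; _<_; _+_; _-_; -_) renaming (∣_∣ to ∣_∣ℚ)
open import Data.Integer using (+_)
open import Data.Product using (_×_; Σ; ∃; ∃-syntax; _,_)
open import Data.Bool using (if_then_else_)
open import Relation.Nullary using (¬_)
open import Relation.Nullary.Decidable using (⌊_⌋)
open import Relation.Binary.PropositionalEquality using (_≡_; _≢_)
import Data.Fin as Fin

record Intervals (n : ℕ) : Set where
  field
    s e : Fin n → ℚ
    e-pos   : ∀ i → 0ℚ < e i
    e-≤1    : ∀ i → e i ≤ 1ℚ
    s->-1   : ∀ i → - 1ℚ < s i
    len-≤1  : ∀ i → e i - s i ≤ 1ℚ
open Intervals public

Disjoint : ℚ → ℚ → ℚ → ℚ → Set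
Disjoint a b c d = ∀ x → ¬ ((a ≤ x × x < b) × (c ≤ x × x < d))

InU : ∀ {n} → Intervals n → Fin n → Set
InU I i = s I i ≤ 0ℚ

Pair : ℕ → Set
Pair n = Subset n × Subset n

IsSchedule : ∀ {n} → Intervals n → Pair n → Set
IsSchedule I (T , W) = (∀ i → i ∈ W → InU I i) × ∣ W ∣ ℕ.≤ 1

NonOverlapping : ∀ {n} → Intervals n → Pair n → Set
NonOverlapping I (T , W) =
  ∀ i′ → i′ ∈ T →
    (∀ i″ → i″ ∈ T → i″ ≢ i′ → Disjoint (s I i′) (e I i′) (s I i″) (e I i″))
  × (∀ i → i ∈ W → Disjoint (s I i′) (e I i′) (s I i + 1ℚ) (e I i + 1ℚ))

record ScheduleSet {n : ℕ} (I : Intervals n) : Set₁ where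
  field
    S        : Pair n → Set
    schedule : ∀ p → S p → IsSchedule I p × NonOverlapping I p
open ScheduleSet public

-- Assignments f : [n] × ℤ_{>0} → [q]; weeks are r ≥ 1, the value at r = 0 is irrelevant.
Assignment : ℕ → ℕ → Set
Assignment n q = Fin n → ℕ → Fin q

induced : ∀ {n q} → Intervals n → Assignment n q → Fin q → ℕ → Pair n
induced I f j r =
  tabulate (λ i → if ⌊ f i r Fin.≟ j ⌋ then inside else outside) ,
  tabulate (λ i → if ⌊ ℚ._≤?_ (s I i) 0ℚ ⌋ then (if ⌊ f i (suc r) Fin.≟ j ⌋ then inside else outside) else outside)

Feasible : ∀ {n q} {I : Intervals n} → ScheduleSet I → Assignment n q → Set
Feasible {I = I} 𝒮 f = ∀ j r → 1 ℕ.≤ r → S 𝒮 (induced I f j r)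

count : ∀ {n q} → Assignment n q → Fin n → Fin q → ℕ → ℕ
count f i j zero    = 0
count f i j (suc t) = count f i j t ℕ.+ (if ⌊ f i (suc t) Fin.≟ j ⌋ then 1 else 0)

Balanced : ∀ {n q} .{{_ : NonZero q}} → Assignment n q → Set
Balanced {q = q} f = ∀ i j → ∀ ε → 0ℚ < ε → ∃[ N ] ∀ t → N ℕ.≤ suc t →
  ∣ (+ count f i j (suc t)) ℚ./ suc t - (+ 1) ℚ./ q ∣ℚ < ε

Periodic : ∀ {n q} → Assignment n q → ℕ → Set
Periodic f h = ∀ i r → 1 ℕ.≤ r → f i r ≡ f i (r ℕ.+ h)

{-# OPTIONS --safe #-}

-- Two tasks with s ≤ 0 both contain the time 0, so they never share a worker. Hence every week r has
-- a bijection x r from workers to "positions" that sends the worker of each such task to a position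
-- depending only on the task, and passing from week r to week r + 1 is a permutation of positions.
-- Weeks of the given assignment can then be replayed in any order, the workers being permuted
-- accordingly, without creating new schedules. If some task has s ≤ 0, balance makes every worker
-- perform it, so the permutations of finitely many weeks act transitively on positions; if there is
-- none, the x r are arbitrary and can be chosen so. At most q² weeks are needed, one per pair of
-- positions joined by some week. An Eulerian circuit in the Schreier graph with the q! bijections
-- from positions to workers as vertices and these weeks as labels is a periodic assignment in which,
-- for each label, every worker meets every position equally often. The circuit is obtained by
-- merging the cycles of a successor permutation on the edges.
module Submission where

open import Defs
open import Data.Bool using (if_then_else_)
open import Data.Fin as Fin using (Fin; toℕ; combine; remQuot; punchIn; _↑ˡ_; _↑ʳ_)
open import Data.Fin.Permutation using (Permutation′; permutation; _⟨$⟩ʳ_; _⟨$⟩ˡ_; inverseˡ; inverseʳ; _∘ₚ_; flip; transpose; insert; remove; insert-remove) renaming (_≈_ to _≈ₚ_; id to idₚ)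
open import Data.Fin.Properties as Finₚ using (_≟_; pigeonhole; toℕ<n; toℕ-fromℕ<; any?; combine-remQuot; remQuot-combine; punchIn-injective)
open import Data.Fin.Subset using (_∈_; inside; outside)
import Data.Integer as ℤ
import Data.Integer.Properties as ℤₚ
open import Data.List using ([]; _∷_; allFin)
open import Data.List.Membership.Propositional.Properties using (∈-allFin)
open import Data.List.Relation.Unary.All as All using (All; []; _∷_)
open import Data.Nat as ℕ using (ℕ; zero; suc; pred; _+_; _*_; _^_; _≤_; _<_; s≤s; z≤n; _!; _∸_; NonZero)
open import Data.Nat.Coprimality using (Coprime)
open import Data.Nat.DivMod using (_/_; _%_; _mod_; m≡m%n+[m/n]*n; m%n<n; m<n⇒m%n≡m)
open import Data.Nat.Properties as ℕₚ using (+-*-semiring)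
open import Algebra.Properties.Semiring.Sum +-*-semiring
open import Data.Product using (_×_; ∃-syntax; _,_; proj₁; proj₂)
open import Data.Rational as ℚ using (0ℚ; mkℚ; toℚᵘ; fromℚᵘ)
import Data.Rational.Properties as ℚₚ
open import Data.Rational.Unnormalised as ℚᵘ using (ℚᵘ; mkℚᵘ; *<*)
import Data.Rational.Unnormalised.Properties as ℚᵘₚ
open import Data.Sum using (_⊎_; inj₁; inj₂)
open import Data.Vec.Properties using (lookup⇒[]=; lookup∘tabulate; tabulate-cong)
open import Function using (_∘_)
open import Relation.Binary.Construct.Closure.Equivalence as Eq using (EqClosure)
open import Relation.Binary.PropositionalEquality
open import Relation.Nullary using (Dec; yes; no; contradiction)
open import Relation.Nullary.Decidable using (⌊_⌋; dec-true; dec-false)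

-- Permutations and transpositions

perm-injective : ∀ {n} (π : Permutation′ n) {a b} → π ⟨$⟩ʳ a ≡ π ⟨$⟩ʳ b → a ≡ b
perm-injective π eq = trans (sym (inverseˡ π)) (trans (cong (π ⟨$⟩ˡ_) eq) (inverseˡ π))

transpose-i : ∀ {n} (i j : Fin n) → transpose i j ⟨$⟩ʳ i ≡ j
transpose-i i j rewrite dec-true (i ≟ i) refl = refl

transpose-j : ∀ {n} (i j : Fin n) → transpose i j ⟨$⟩ʳ j ≡ i
transpose-j i j with j ≟ i
... | yes j≡i = j≡i
... | no  _ rewrite dec-true (j ≟ j) refl = refl

transpose-k : ∀ {n} (i j : Fin n) {k} → k ≢ i → k ≢ j → transpose i j ⟨$⟩ʳ k ≡ k
transpose-k i j {k} k≢i k≢j rewrite dec-false (k ≟ i) k≢i | dec-false (k ≟ j) k≢j = refl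

-- Cycles of a permutation

orbit : ∀ {A : Set} → (A → A) → A → ℕ → A
orbit τ e zero    = e
orbit τ e (suc k) = τ (orbit τ e k)

orbit-+ : ∀ {A : Set} (τ : A → A) e k l → orbit τ e (k + l) ≡ orbit τ (orbit τ e l) k
orbit-+ τ e zero    l = refl
orbit-+ τ e (suc k) l = cong τ (orbit-+ τ e k l)

-- Two of the first `N + 1` iterates coincide, and injectivity of `τ` cancels their common initial
-- steps. The bound by `N` later becomes the bound on the period.
orbit-returns : ∀ {N} (τ : Permutation′ N) e →
  ∃[ h ] (suc h ≤ N × orbit (τ ⟨$⟩ʳ_) e (suc h) ≡ e)
orbit-returns {N} τ e = returns (pigeonhole (ℕₚ.n<1+n N) (orbit (τ ⟨$⟩ʳ_) e ∘ toℕ))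
  where
  cancel : ∀ a {d} → orbit (τ ⟨$⟩ʳ_) e (a + d) ≡ orbit (τ ⟨$⟩ʳ_) e a → orbit (τ ⟨$⟩ʳ_) e d ≡ e
  cancel zero    eq = eq
  cancel (suc a) eq = cancel a (perm-injective τ eq)

  returns : (∃[ i ] ∃[ j ] (i Fin.< j × orbit (τ ⟨$⟩ʳ_) e (toℕ i) ≡ orbit (τ ⟨$⟩ʳ_) e (toℕ j))) →
    ∃[ h ] (suc h ≤ N × orbit (τ ⟨$⟩ʳ_) e (suc h) ≡ e)
  returns (i , j , i<j , eq) =
    h , ℕₚ.≤-trans (ℕₚ.m≤n+m (suc h) (toℕ i)) (ℕₚ.≤-trans (ℕₚ.≤-reflexive split) (ℕₚ.≤-pred (toℕ<n j))) ,
    cancel (toℕ i) (trans (cong (orbit (τ ⟨$⟩ʳ_) e) split) (sym eq))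
    where
    h = toℕ j ∸ suc (toℕ i)
    split : toℕ i + suc h ≡ toℕ j
    split = trans (ℕₚ.+-suc (toℕ i) h) (ℕₚ.m+[n∸m]≡n i<j)

-- As an equivalence closure it lets a fold show that functions invariant under `τ` are constant on
-- cycles.
SameCycle : ∀ {N} → Permutation′ N → Fin N → Fin N → Set
SameCycle τ = EqClosure (λ a b → τ ⟨$⟩ʳ a ≡ b)

module _ {N} (τ : Permutation′ N) (u v : Fin N) where

  private
    τ′ : Permutation′ N
    τ′ = τ ∘ₚ transpose u v

    step : ∀ {a b} → τ′ ⟨$⟩ʳ a ≡ b → SameCycle τ′ a b
    step = Eq.return

    sym~ : ∀ {a b} → SameCycle τ′ a b → SameCycle τ′ b a
    sym~ = Eq.symmetric _

    trans~ : ∀ {a b c} → SameCycle τ′ a b → SameCycle τ′ b c → SameCycle τ′ a c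
    trans~ = Eq.transitive _

  -- Until it first returns to u, the τ-orbit of u is also a τ′-orbit, because it never meets v;
  -- at the return, τ′ moves on to v instead.
  transpose-joins : ∀ h → orbit (τ ⟨$⟩ʳ_) u (suc h) ≡ u →
    (∀ k → k ≤ h → orbit (τ ⟨$⟩ʳ_) u k ≢ v) → SameCycle τ′ u v
  transpose-joins h ret avoid = finish (follow h ℕₚ.≤-refl)
    where
    leave : ∀ {a} → SameCycle τ′ u a → τ ⟨$⟩ʳ a ≡ u → SameCycle τ′ u v
    leave p eq = trans~ p (step (trans (cong (transpose u v ⟨$⟩ʳ_) eq) (transpose-i u v)))

    follow : ∀ k → k ≤ h → SameCycle τ′ u v ⊎ SameCycle τ′ u (orbit (τ ⟨$⟩ʳ_) u k)
    follow zero    _   = inj₂ (Eq.reflexive _)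
    follow (suc k) k<h with follow k (ℕₚ.<⇒≤ k<h)
    ... | inj₁ p = inj₁ p
    ... | inj₂ p with orbit (τ ⟨$⟩ʳ_) u (suc k) ≟ u
    ...   | yes eq = inj₁ (leave p eq)
    ...   | no  ≢u = inj₂ (trans~ p (step (transpose-k u v ≢u (avoid (suc k) k<h))))

    finish : SameCycle τ′ u v ⊎ SameCycle τ′ u (orbit (τ ⟨$⟩ʳ_) u h) → SameCycle τ′ u v
    finish (inj₁ p) = p
    finish (inj₂ p) = leave p ret

  -- `τ′` differs from `τ` only in exchanging the images `u` and `v`, which is harmless once `u` and
  -- `v` share a cycle.
  transpose-coarsens : SameCycle τ′ u v → ∀ {a b} → SameCycle τ a b → SameCycle τ′ a b
  transpose-coarsens u~v = Eq.fold (Eq.isEquivalence _) edge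
    where
    edge : ∀ {a b} → τ ⟨$⟩ʳ a ≡ b → SameCycle τ′ a b
    edge {a} refl with τ ⟨$⟩ʳ a ≟ u | τ ⟨$⟩ʳ a ≟ v
    ... | yes eq | _ = subst (SameCycle τ′ a) (sym eq)
          (trans~ (step (trans (cong (transpose u v ⟨$⟩ʳ_) eq) (transpose-i u v))) (sym~ u~v))
    ... | no _ | yes eq = subst (SameCycle τ′ a) (sym eq)
          (trans~ (step (trans (cong (transpose u v ⟨$⟩ʳ_) eq) (transpose-j u v))) u~v)
    ... | no ≢u | no ≢v = step (transpose-k u v ≢u ≢v)

-- Postcomposing τ with transpositions of edges that leave the same vertex keeps τ a successor function.
record Coarsening {N} {X : Set} (tail : Fin N → X) (τ : Permutation′ N)
  (P : Permutation′ N → Set) : Set where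
  field
    τ′      : Permutation′ N
    coarser : ∀ {a b} → SameCycle τ a b → SameCycle τ′ a b
    tails   : ∀ e → tail (τ′ ⟨$⟩ʳ e) ≡ tail (τ ⟨$⟩ʳ e)
    holds   : P τ′

transpose-preserves : ∀ {N} {X : Set} (g : Fin N → X) {u v} → g u ≡ g v → ∀ e → g (transpose u v ⟨$⟩ʳ e) ≡ g e
transpose-preserves g {u} {v} eq e = by-cases (e ≟ u) (e ≟ v)
  where
  by-cases : Dec (e ≡ u) → Dec (e ≡ v) → g (transpose u v ⟨$⟩ʳ e) ≡ g e
  by-cases (yes refl) _          = trans (cong g (transpose-i u v)) (sym eq)
  by-cases (no _)     (yes refl) = trans (cong g (transpose-j u v)) eq
  by-cases (no ≢u)    (no ≢v)    = cong g (transpose-k u v ≢u ≢v)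

-- If the orbit of `u` meets `v`, `τ` itself works; otherwise the transposition merges two cycles.
-- The return after `suc h` steps makes the search finite.
join : ∀ {N} {X : Set} (tail : Fin N → X) τ {u v} → tail u ≡ tail v → Coarsening tail τ (λ τ′ → SameCycle τ′ u v)
join tail τ {u} {v} eq with orbit-returns τ u
... | h , _ , ret with any? {suc h} (λ k → orbit (τ ⟨$⟩ʳ_) u (toℕ k) ≟ v)
... | yes (k , hit) = record { τ′ = τ ; coarser = λ p → p ; tails = λ _ → refl ; holds = subst (SameCycle τ u) hit (reach (toℕ k)) }
  where
  reach : ∀ k → SameCycle τ u (orbit (τ ⟨$⟩ʳ_) u k)
  reach zero    = Eq.reflexive _
  reach (suc k) = Eq.transitive _ (reach k) (Eq.return refl)
... | no miss = record
  { τ′ = τ ∘ₚ transpose u v ; coarser = transpose-coarsens τ u v u~v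
  ; tails = λ e → transpose-preserves tail eq (τ ⟨$⟩ʳ e) ; holds = u~v }
  where
  u~v = transpose-joins τ u v h ret λ k k≤h hit → miss (Fin.fromℕ< (s≤s k≤h) ,
    trans (cong (orbit (τ ⟨$⟩ʳ_) u) (toℕ-fromℕ< (s≤s k≤h))) hit)

-- Each further join only coarsens the cycle relation, so pairs joined earlier stay joined.
joinAll : ∀ {N} {X : Set} (tail : Fin N → X) (base : Fin N → Fin N) → (∀ e → tail e ≡ tail (base e)) →
  ∀ τ es → Coarsening tail τ (λ τ′ → All (λ e → SameCycle τ′ e (base e)) es)
joinAll tail base eq τ [] = record { τ′ = τ ; coarser = λ p → p ; tails = λ _ → refl ; holds = [] }
joinAll tail base eq τ (e ∷ es) = record
  { τ′ = C₂.τ′ ; coarser = λ p → C₂.coarser (C₁.coarser p)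
  ; tails = λ a → trans (C₂.tails a) (C₁.tails a)
  ; holds = C₂.holds ∷ All.map C₂.coarser C₁.holds }
  where
  module C₁ = Coarsening (joinAll tail base eq τ es)
  module C₂ = Coarsening (join tail C₁.τ′ (eq e))

-- Lehmer codes

decode : ∀ n → Fin (n !) → Permutation′ n
decode zero    _ = idₚ
decode (suc n) x = insert Fin.zero (proj₁ (remQuot (n !) x)) (decode n (proj₂ (remQuot {suc n} (n !) x)))

encode : ∀ n → Permutation′ n → Fin (n !)
encode zero    _ = Fin.zero
encode (suc n) π = combine (π ⟨$⟩ʳ Fin.zero) (encode n (remove Fin.zero π))

insert-cong : ∀ {n} (j : Fin (suc n)) {π ρ : Permutation′ n} → π ≈ₚ ρ → insert Fin.zero j π ≈ₚ insert Fin.zero j ρ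
insert-cong j eq Fin.zero    = refl
insert-cong j eq (Fin.suc k) = cong (punchIn j) (eq k)

decode-encode : ∀ n π → decode n (encode n π) ≈ₚ π
decode-encode (suc n) π k = trans
  (cong (λ p → insert Fin.zero (proj₁ p) (decode n (proj₂ p)) ⟨$⟩ʳ k)
    (remQuot-combine (π ⟨$⟩ʳ Fin.zero) (encode n (remove Fin.zero π))))
  (trans (insert-cong (π ⟨$⟩ʳ Fin.zero) (decode-encode n (remove Fin.zero π)) k) (insert-remove Fin.zero π k))

-- Turns pointwise agreement of permutations into equality of codes, so that `move` has an inverse
-- on the nose.
decode-injective : ∀ n {x y} → decode n x ≈ₚ decode n y → x ≡ y
decode-injective zero    {Fin.zero} {Fin.zero} _ = refl
decode-injective (suc n) {x} {y} eq = trans (sym (combine-remQuot {suc n} (n !) x))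
  (trans (cong₂ combine hd (decode-injective n tl)) (combine-remQuot {suc n} (n !) y))
  where
  hd : proj₁ (remQuot {suc n} (n !) x) ≡ proj₁ (remQuot (n !) y)
  hd = eq Fin.zero
  tl : decode n (proj₂ (remQuot {suc n} (n !) x)) ≈ₚ decode n (proj₂ (remQuot {suc n} (n !) y))
  tl k = punchIn-injective (proj₁ (remQuot {suc n} (n !) x)) _ _ (trans (eq (Fin.suc k)) (cong (λ i → punchIn i (decode n (proj₂ (remQuot {suc n} (n !) y)) ⟨$⟩ʳ k)) (sym hd)))

-- Finite sums

if-cong : {A P Q : Set} {a b : A} → (P → Q) → (Q → P) → (p : Dec P) (q : Dec Q) →
  (if ⌊ p ⌋ then a else b) ≡ (if ⌊ q ⌋ then a else b)
if-cong f g (yes p) (yes q) = refl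
if-cong f g (yes p) (no ¬q) = contradiction (f p) ¬q
if-cong f g (no ¬p) (yes q) = contradiction (g q) ¬p
if-cong f g (no ¬p) (no ¬q) = refl

⟦_⟧ : {P : Set} → Dec P → ℕ
⟦ d ⟧ = if ⌊ d ⌋ then 1 else 0

⟦⟧-cong : {P Q : Set} → (P → Q) → (Q → P) → (p : Dec P) (q : Dec Q) → ⟦ p ⟧ ≡ ⟦ q ⟧
⟦⟧-cong = if-cong

∑-const : ∀ n c → ∑[ _ < n ] c ≡ n * c
∑-const zero    c = refl
∑-const (suc n) c = cong (c +_) (∑-const n c)

∑-δ : ∀ {n} (a : Fin n) (φ : Fin n → ℕ) → ∑[ x < n ] (⟦ a ≟ x ⟧ * φ x) ≡ φ a
∑-δ {suc n} Fin.zero φ =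
  trans (cong₂ _+_ (ℕₚ.*-identityˡ (φ Fin.zero)) (trans (∑-const n 0) (ℕₚ.*-zeroʳ n))) (ℕₚ.+-identityʳ _)
∑-δ {suc n} (Fin.suc a) φ = trans
  (sum-cong-≗ (λ x → cong (_* φ (Fin.suc x)) (⟦⟧-cong Finₚ.suc-injective (cong Fin.suc) (Fin.suc a ≟ Fin.suc x) (a ≟ x))))
  (∑-δ a (φ ∘ Fin.suc))

∑-↑ : ∀ m n (g : Fin (m + n) → ℕ) → sum g ≡ ∑[ a < m ] g (a ↑ˡ n) + ∑[ b < n ] g (m ↑ʳ b)
∑-↑ zero    n g = refl
∑-↑ (suc m) n g = trans (cong (g Fin.zero +_) (∑-↑ m n (g ∘ Fin.suc))) (sym (ℕₚ.+-assoc (g Fin.zero) _ _))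

∑-combine : ∀ m n (g : Fin (m * n) → ℕ) → sum g ≡ ∑[ a < m ] ∑[ b < n ] g (combine a b)
∑-combine zero    n g = refl
∑-combine (suc m) n g = trans (∑-↑ n (m * n) g) (cong (∑[ b < n ] g (b ↑ˡ (m * n)) +_) (∑-combine m n (g ∘ (n ↑ʳ_))))

∑-perm-δ : ∀ {n} (π : Permutation′ n) j → ∑[ p < n ] ⟦ π ⟨$⟩ʳ p ≟ j ⟧ ≡ 1
∑-perm-δ {n} π j = begin
  ∑[ p < n ] ⟦ π ⟨$⟩ʳ p ≟ j ⟧  ≡⟨ sum-permute (λ p → ⟦ p ≟ j ⟧) π ⟨
  ∑[ p < n ] ⟦ p ≟ j ⟧        ≡⟨ sum-cong-≗ (λ p → trans (⟦⟧-cong sym sym (p ≟ j) (j ≟ p)) (sym (ℕₚ.*-identityʳ _))) ⟩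
  ∑[ p < n ] (⟦ j ≟ p ⟧ * 1)  ≡⟨ ∑-δ j (λ _ → 1) ⟩
  1                           ∎
  where open ≡-Reasoning

sumTo : (ℕ → ℕ) → ℕ → ℕ
sumTo g zero    = 0
sumTo g (suc t) = sumTo g t + g t

sumTo-cong : ∀ {g g′} → (∀ t → g t ≡ g′ t) → ∀ h → sumTo g h ≡ sumTo g′ h
sumTo-cong eq zero    = refl
sumTo-cong eq (suc h) = cong₂ _+_ (sumTo-cong eq h) (eq h)

sumTo-1 : ∀ h → sumTo (λ _ → 1) h ≡ h
sumTo-1 zero    = refl
sumTo-1 (suc h) = trans (ℕₚ.+-comm (sumTo (λ _ → 1) h) 1) (cong suc (sumTo-1 h))

sumTo-*ʳ : ∀ g c h → sumTo (λ t → g t * c) h ≡ sumTo g h * c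
sumTo-*ʳ g c zero    = refl
sumTo-*ʳ g c (suc h) = trans (cong (_+ g h * c) (sumTo-*ʳ g c h)) (sym (ℕₚ.*-distribʳ-+ c (sumTo g h) (g h)))

sumTo-∑ : ∀ {n} (g : ℕ → Fin n → ℕ) h → sumTo (λ t → sum (g t)) h ≡ ∑[ x < n ] sumTo (λ t → g t x) h
sumTo-∑ {n} g zero    = sym (trans (∑-const n 0) (ℕₚ.*-zeroʳ n))
sumTo-∑ {n} g (suc h) = trans (cong (_+ sum (g h)) (sumTo-∑ g h)) (sym (∑-distrib-+ (λ x → sumTo (λ t → g t x) h) (g h)))

sumTo-suc : ∀ g h → sumTo (g ∘ suc) h + g 0 ≡ sumTo g (suc h)
sumTo-suc g zero    = refl
sumTo-suc g (suc h) = begin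
  sumTo (g ∘ suc) h + g (suc h) + g 0    ≡⟨ ℕₚ.+-assoc (sumTo (g ∘ suc) h) _ _ ⟩
  sumTo (g ∘ suc) h + (g (suc h) + g 0)  ≡⟨ cong (sumTo (g ∘ suc) h +_) (ℕₚ.+-comm (g (suc h)) (g 0)) ⟩
  sumTo (g ∘ suc) h + (g 0 + g (suc h))  ≡⟨ ℕₚ.+-assoc (sumTo (g ∘ suc) h) _ _ ⟨
  sumTo (g ∘ suc) h + g 0 + g (suc h)    ≡⟨ cong (_+ g (suc h)) (sumTo-suc g h) ⟩
  sumTo g (suc h) + g (suc h)            ∎
  where open ≡-Reasoning

sumTo-shift : ∀ g h → g h ≡ g 0 → sumTo (g ∘ suc) h ≡ sumTo g h
sumTo-shift g h eq = ℕₚ.+-cancelʳ-≡ (g 0) _ _ (trans (sumTo-suc g h) (cong (sumTo g h +_) eq))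

visits : ∀ {N} → (ℕ → Fin N) → ℕ → Fin N → ℕ
visits e h a = sumTo (λ t → ⟦ e t ≟ a ⟧) h

sumTo-visits : ∀ {N} (e : ℕ → Fin N) h (φ : Fin N → ℕ) → sumTo (φ ∘ e) h ≡ ∑[ a < N ] (visits e h a * φ a)
sumTo-visits {N} e h φ = begin
  sumTo (φ ∘ e) h                                  ≡⟨ sumTo-cong (λ t → sym (∑-δ (e t) φ)) h ⟩
  sumTo (λ t → ∑[ a < N ] (⟦ e t ≟ a ⟧ * φ a)) h   ≡⟨ sumTo-∑ (λ t a → ⟦ e t ≟ a ⟧ * φ a) h ⟩
  ∑[ a < N ] sumTo (λ t → ⟦ e t ≟ a ⟧ * φ a) h     ≡⟨ sum-cong-≗ (λ a → sumTo-*ʳ (λ t → ⟦ e t ≟ a ⟧) (φ a) h) ⟩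
  ∑[ a < N ] (visits e h a * φ a)                  ∎
  where open ≡-Reasoning

-- Eulerian circuits

-- State t is the bijection from positions to workers in week t, and label t the week that is replayed.
record UniformWalk {q ℓ} (ρ : Fin ℓ → Permutation′ q) : Set where
  field
    state     : ℕ → Permutation′ q
    label     : ℕ → Fin ℓ
    h         : ℕ
    h≥1       : 1 ≤ h
    h≤        : h ≤ ℓ * q !
    state-suc : ∀ t p → state (suc t) ⟨$⟩ʳ p ≡ state t ⟨$⟩ʳ (ρ (label t) ⟨$⟩ʳ p)
    state-per : ∀ t → state (t + h) ≡ state t
    label-per : ∀ t → label (t + h) ≡ label t
    uniform   : ∀ (pos : Fin ℓ → Fin q) j →
                q * sumTo (λ t → ⟦ state t ⟨$⟩ʳ pos (label t) ≟ j ⟧) h ≡ h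

-- Edges are pairs of a label and a (numbered) state, combined into Fin N.
module _ {q ℓ} (ρ : Fin (suc ℓ) → Permutation′ q)
  (connected : ∀ p p′ → EqClosure (λ a b → ∃[ l ] ρ l ⟨$⟩ʳ a ≡ b) p p′) where

  private
    N = suc ℓ * q !

    move-inv : ∀ (π : Permutation′ q) x → encode q (π ∘ₚ decode q (encode q (flip π ∘ₚ decode q x))) ≡ x
    move-inv π x = decode-injective q λ k → trans (decode-encode q _ k)
      (trans (decode-encode q _ (π ⟨$⟩ʳ k)) (cong (decode q x ⟨$⟩ʳ_) (inverseˡ π)))

    move : Fin (suc ℓ) → Permutation′ (q !)
    move l = permutation (λ x → encode q (ρ l ∘ₚ decode q x)) (λ x → encode q (flip (ρ l) ∘ₚ decode q x))
      (move-inv (ρ l)) (move-inv (flip (ρ l)))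

    decode-move : ∀ l x p → decode q (move l ⟨$⟩ʳ x) ⟨$⟩ʳ p ≡ decode q x ⟨$⟩ʳ (ρ l ⟨$⟩ʳ p)
    decode-move l x p = decode-encode q (ρ l ∘ₚ decode q x) p

    tail : Fin N → Fin (q !)
    tail e = proj₂ (remQuot {suc ℓ} (q !) e)

    lab : Fin N → Fin (suc ℓ)
    lab e = proj₁ (remQuot {suc ℓ} (q !) e)

    tail-combine : ∀ l x → tail (combine l x) ≡ x
    tail-combine l x = cong proj₂ (remQuot-combine {suc ℓ} l x)

    lab-combine : ∀ l x → lab (combine l x) ≡ l
    lab-combine l x = cong proj₁ (remQuot-combine {suc ℓ} l x)

    -- For `μ = move` this is the initial successor function: an edge is followed by the edge with
    -- the same label at its head. The inverse has the same shape, with `flip ∘ μ`.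
    relabel : (Fin (suc ℓ) → Permutation′ (q !)) → Fin N → Fin N
    relabel μ e = combine (lab e) (μ (lab e) ⟨$⟩ʳ tail e)

    relabel-inv : ∀ μ e → relabel μ (relabel (flip ∘ μ) e) ≡ e
    relabel-inv μ e = trans
      (cong₂ (λ l x → combine l (μ l ⟨$⟩ʳ x)) (lab-combine (lab e) _) (tail-combine (lab e) _))
      (trans (cong (combine (lab e)) (inverseʳ (μ (lab e)))) (combine-remQuot {suc ℓ} (q !) e))

    base : Fin N → Fin N
    base e = combine {suc ℓ} Fin.zero (tail e)

    -- Joining every edge to the edge with label zero at its tail puts all edges that leave a vertex
    -- on one cycle.
    open Coarsening (joinAll tail base (λ e → sym (tail-combine Fin.zero (tail e)))
      (permutation (relabel move) (relabel (flip ∘ move)) (relabel-inv move) (relabel-inv (flip ∘ move)))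
      (allFin N)) renaming (τ′ to τ)

    tail-τ : ∀ e → tail (τ ⟨$⟩ʳ e) ≡ move (lab e) ⟨$⟩ʳ tail e
    tail-τ e = trans (tails e) (tail-combine (lab e) _)

    e₀ : Fin N
    e₀ = combine {suc ℓ} Fin.zero (encode q idₚ)

    edge : ℕ → Fin N
    edge = orbit (τ ⟨$⟩ʳ_) e₀

    H = suc (proj₁ (orbit-returns τ e₀))

    edge-H : edge H ≡ e₀
    edge-H = proj₂ (proj₂ (orbit-returns τ e₀))

    edge-per : ∀ t → edge (t + H) ≡ edge t
    edge-per t = trans (orbit-+ (τ ⟨$⟩ʳ_) e₀ t H) (cong (λ e → orbit (τ ⟨$⟩ʳ_) e t) edge-H)

    m : Fin N → ℕ
    m = visits edge H

    -- `τ` is injective, so a visit to `e` is exactly a visit to `τ ⟨$⟩ʳ e` one step later, and on a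
    -- closed walk the shift by one step does not change the count.
    m-τ : ∀ e → m e ≡ m (τ ⟨$⟩ʳ e)
    m-τ e = trans
      (sumTo-cong (λ t → ⟦⟧-cong (cong (τ ⟨$⟩ʳ_)) (perm-injective τ) (edge t ≟ e) (edge (suc t) ≟ τ ⟨$⟩ʳ e)) H)
      (sumTo-shift (λ t → ⟦ edge t ≟ τ ⟨$⟩ʳ e ⟧) H (cong (λ a → ⟦ a ≟ τ ⟨$⟩ʳ e ⟧) edge-H))

    m-cycle : ∀ {a b} → SameCycle τ a b → m a ≡ m b
    m-cycle = Eq.gfold isEquivalence m λ { {a} refl → m-τ a }

    m-base : ∀ e → m e ≡ m (base e)
    m-base e = m-cycle (All.lookup holds (∈-allFin e))

    -- The common multiplicity of all edges leaving `x`; it is zero at vertices that the circuit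
    -- does not reach.
    w : Fin (q !) → ℕ
    w x = m (combine {suc ℓ} Fin.zero x)

    m-combine : ∀ l x → m (combine l x) ≡ w x
    m-combine l x = trans (m-base (combine l x)) (cong w (tail-combine l x))

    -- The successor of the edge `combine l x` leaves the vertex `move l ⟨$⟩ʳ x` and has the same
    -- multiplicity.
    w-move : ∀ l x → w (move l ⟨$⟩ʳ x) ≡ w x
    w-move l x = begin
      w (move l ⟨$⟩ʳ x)              ≡⟨ cong w (cong₂ (λ l x → move l ⟨$⟩ʳ x) (lab-combine l x) (tail-combine l x)) ⟨
      w (move (lab a) ⟨$⟩ʳ tail a)   ≡⟨ cong w (tail-τ a) ⟨
      m (base (τ ⟨$⟩ʳ a))            ≡⟨ m-base (τ ⟨$⟩ʳ a) ⟨
      m (τ ⟨$⟩ʳ a)                   ≡⟨ m-τ a ⟨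
      m a                            ≡⟨ m-combine l x ⟩
      w x                            ∎
      where
      open ≡-Reasoning
      a = combine l x

    -- How often, per label, worker j meets position p.
    c : Fin q → Fin q → ℕ
    c j p = ∑[ x < q ! ] (w x * ⟦ decode q x ⟨$⟩ʳ p ≟ j ⟧)

    -- Reindexing the states by `move l` preserves the weights and replaces position `p` by
    -- `ρ l ⟨$⟩ʳ p`.
    c-ρ : ∀ j l p → c j p ≡ c j (ρ l ⟨$⟩ʳ p)
    c-ρ j l p = trans (sum-permute _ (move l)) (sum-cong-≗ λ x →
      cong₂ _*_ (w-move l x) (cong (λ k → ⟦ k ≟ j ⟧) (decode-move l x p)))

    c-const : ∀ j p p′ → c j p ≡ c j p′
    c-const j p p′ = Eq.gfold isEquivalence (c j) (λ { {a} (l , refl) → c-ρ j l a }) (connected p p′)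

    -- By connectedness `c j` is constant, and in every state worker `j` holds exactly one of the
    -- `q` positions.
    q*c : ∀ j p → q * c j p ≡ sum w
    q*c j p = begin
      q * c j p                                                       ≡⟨ ∑-const q (c j p) ⟨
      ∑[ _ < q ] c j p                                                ≡⟨ sum-cong-≗ (c-const j p) ⟩
      ∑[ p′ < q ] c j p′                                              ≡⟨ ∑-comm (λ p′ x → w x * ⟦ decode q x ⟨$⟩ʳ p′ ≟ j ⟧) ⟩
      ∑[ x < q ! ] ∑[ p′ < q ] (w x * ⟦ decode q x ⟨$⟩ʳ p′ ≟ j ⟧)     ≡⟨ sum-cong-≗ (λ x → trans
                                                                          (sym (*-distribˡ-sum (w x) (λ p′ → ⟦ decode q x ⟨$⟩ʳ p′ ≟ j ⟧)))
                                                                          (trans (cong (w x *_) (∑-perm-δ (decode q x) j)) (ℕₚ.*-identityʳ (w x)))) ⟩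
      sum w                                                           ∎
      where open ≡-Reasoning

    sumTo-edge : ∀ φ → sumTo (φ ∘ edge) H ≡ ∑[ l < suc ℓ ] ∑[ x < q ! ] (w x * φ (combine l x))
    sumTo-edge φ = trans (sumTo-visits edge H φ) (trans (∑-combine (suc ℓ) (q !) (λ e → m e * φ e))
      (sum-cong-≗ λ l → sum-cong-≗ λ x → cong (_* φ (combine l x)) (m-combine l x)))

    -- Label `l` contributes `c j (pos l)`, and `q` times this is `sum w` whatever the position is.
    -- The total `H` decomposes in the same way, with `sum w` per label.
    uniform′ : ∀ (pos : Fin (suc ℓ) → Fin q) j →
      q * sumTo (λ t → ⟦ decode q (tail (edge t)) ⟨$⟩ʳ pos (lab (edge t)) ≟ j ⟧) H ≡ H
    uniform′ pos j = begin
      q * sumTo (φ ∘ edge) H                                           ≡⟨ cong (q *_) (sumTo-edge φ) ⟩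
      q * ∑[ l < suc ℓ ] ∑[ x < q ! ] (w x * φ (combine l x))          ≡⟨ cong (q *_) (sum-cong-≗ λ l → sum-cong-≗ λ x → cong (w x *_)
                                                                           (cong₂ (λ x l → ⟦ decode q x ⟨$⟩ʳ pos l ≟ j ⟧) (tail-combine l x) (lab-combine l x))) ⟩
      q * ∑[ l < suc ℓ ] c j (pos l)                                   ≡⟨ *-distribˡ-sum q (λ l → c j (pos l)) ⟩
      ∑[ l < suc ℓ ] (q * c j (pos l))                                 ≡⟨ sum-cong-≗ (λ l → trans (q*c j (pos l)) (sum-cong-≗ λ x → sym (ℕₚ.*-identityʳ (w x)))) ⟩
      ∑[ l < suc ℓ ] ∑[ x < q ! ] (w x * 1)                            ≡⟨ sumTo-edge (λ _ → 1) ⟨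
      sumTo (λ _ → 1) H                                                ≡⟨ sumTo-1 H ⟩
      H                                                                ∎
      where
      open ≡-Reasoning
      φ : Fin N → ℕ
      φ e = ⟦ decode q (tail e) ⟨$⟩ʳ pos (lab e) ≟ j ⟧

  abstract
    uniformWalk : UniformWalk ρ
    uniformWalk = record
      { state     = λ t → decode q (tail (edge t))
      ; label     = λ t → lab (edge t)
      ; h         = H
      ; h≥1       = s≤s z≤n
      ; h≤        = proj₁ (proj₂ (orbit-returns τ e₀))
      ; state-suc = λ t p → trans (cong (λ x → decode q x ⟨$⟩ʳ p) (tail-τ (edge t))) (decode-move (lab (edge t)) (tail (edge t)) p)
      ; state-per = λ t → cong (decode q ∘ tail) (edge-per t)
      ; label-per = λ t → cong lab (edge-per t)
      ; uniform   = uniform′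
      }

-- Balance of periodic assignments

count≡sumTo : ∀ {n q} (f : Assignment n q) i j t → count f i j t ≡ sumTo (λ r → ⟦ f i (suc r) ≟ j ⟧) t
count≡sumTo f i j zero    = refl
count≡sumTo f i j (suc t) = cong (_+ ⟦ f i (suc t) ≟ j ⟧) (count≡sumTo f i j t)

⟦⟧≤1 : {P : Set} (d : Dec P) → ⟦ d ⟧ ≤ 1
⟦⟧≤1 (yes _) = s≤s z≤n
⟦⟧≤1 (no _)  = z≤n

sumTo≤ : ∀ {g} → (∀ t → g t ≤ 1) → ∀ h → sumTo g h ≤ h
sumTo≤ g≤1 zero    = z≤n
sumTo≤ g≤1 (suc h) = ℕₚ.≤-trans (ℕₚ.+-mono-≤ (sumTo≤ g≤1 h) (g≤1 h)) (ℕₚ.≤-reflexive (ℕₚ.+-comm h 1))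

module _ {g : ℕ → ℕ} {h : ℕ} (g-per : ∀ t → g (t + h) ≡ g t) where

  sumTo-+h : ∀ t → sumTo g (t + h) ≡ sumTo g t + sumTo g h
  sumTo-+h zero    = refl
  sumTo-+h (suc t) = begin
    sumTo g (t + h) + g (t + h)      ≡⟨ cong₂ _+_ (sumTo-+h t) (g-per t) ⟩
    sumTo g t + sumTo g h + g t      ≡⟨ ℕₚ.+-assoc (sumTo g t) _ _ ⟩
    sumTo g t + (sumTo g h + g t)    ≡⟨ cong (sumTo g t +_) (ℕₚ.+-comm (sumTo g h) (g t)) ⟩
    sumTo g t + (g t + sumTo g h)    ≡⟨ ℕₚ.+-assoc (sumTo g t) _ _ ⟨
    sumTo g t + g t + sumTo g h      ∎
    where open ≡-Reasoning

  sumTo-+a*h : ∀ q → q * sumTo g h ≡ h → ∀ a b → q * sumTo g (b + a * h) ≡ q * sumTo g b + a * h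
  sumTo-+a*h q exact zero    b = trans (cong (λ t → q * sumTo g t) (ℕₚ.+-identityʳ b)) (sym (ℕₚ.+-identityʳ _))
  sumTo-+a*h q exact (suc a) b = begin
    q * sumTo g (b + (h + a * h))              ≡⟨ cong (λ t → q * sumTo g (b + t)) (ℕₚ.+-comm h (a * h)) ⟩
    q * sumTo g (b + (a * h + h))              ≡⟨ cong (λ t → q * sumTo g t) (ℕₚ.+-assoc b (a * h) h) ⟨
    q * sumTo g (b + a * h + h)                ≡⟨ cong (q *_) (sumTo-+h (b + a * h)) ⟩
    q * (sumTo g (b + a * h) + sumTo g h)      ≡⟨ ℕₚ.*-distribˡ-+ q _ _ ⟩
    q * sumTo g (b + a * h) + q * sumTo g h    ≡⟨ cong₂ _+_ (sumTo-+a*h q exact a b) exact ⟩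
    q * sumTo g b + a * h + h                  ≡⟨ ℕₚ.+-assoc (q * sumTo g b) _ _ ⟩
    q * sumTo g b + (a * h + h)                ≡⟨ cong (q * sumTo g b +_) (ℕₚ.+-comm (a * h) h) ⟩
    q * sumTo g b + (h + a * h)                ∎
    where open ≡-Reasoning

  -- Full periods contribute exactly their share; only the remainder `t % h` causes an error, of at
  -- most `q * h`.
  sumTo-bounds : ∀ {q} .{{_ : NonZero q}} .{{_ : NonZero h}} → (∀ t → g t ≤ 1) → q * sumTo g h ≡ h → ∀ t →
    q * sumTo g t ≤ t + q * h × t ≤ q * sumTo g t + q * h
  sumTo-bounds {q} g≤1 exact t = subst (λ t → q * sumTo g t ≤ t + q * h × t ≤ q * sumTo g t + q * h)
    (sym (m≡m%n+[m/n]*n t h)) (upper , lower)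
    where
    b = t % h
    a = t / h
    b≤h : b ≤ h
    b≤h = ℕₚ.<⇒≤ (m%n<n t h)
    open ℕₚ.≤-Reasoning
    upper : q * sumTo g (b + a * h) ≤ b + a * h + q * h
    upper = begin
      q * sumTo g (b + a * h)    ≡⟨ sumTo-+a*h q exact a b ⟩
      q * sumTo g b + a * h      ≤⟨ ℕₚ.+-monoˡ-≤ (a * h) (ℕₚ.*-monoʳ-≤ q (ℕₚ.≤-trans (sumTo≤ g≤1 b) b≤h)) ⟩
      q * h + a * h              ≡⟨ ℕₚ.+-comm (q * h) (a * h) ⟩
      a * h + q * h              ≤⟨ ℕₚ.+-monoˡ-≤ (q * h) (ℕₚ.m≤n+m (a * h) b) ⟩
      b + a * h + q * h          ∎
    lower : b + a * h ≤ q * sumTo g (b + a * h) + q * h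
    lower = begin
      b + a * h                        ≤⟨ ℕₚ.+-monoˡ-≤ (a * h) (ℕₚ.≤-trans b≤h (ℕₚ.m≤n*m h q)) ⟩
      q * h + a * h                    ≡⟨ ℕₚ.+-comm (q * h) (a * h) ⟩
      a * h + q * h                    ≤⟨ ℕₚ.+-monoˡ-≤ (q * h) (ℕₚ.m≤n+m (a * h) (q * sumTo g b)) ⟩
      q * sumTo g b + a * h + q * h    ≡⟨ cong (_+ q * h) (sumTo-+a*h q exact a b) ⟨
      q * sumTo g (b + a * h) + q * h  ∎

∣⊖∣≤ : ∀ a b {K} → a ≤ b + K → b ≤ a + K → ℤ.∣ a ℤ.⊖ b ∣ ≤ K
∣⊖∣≤ a b {K} a≤ b≤ with ℕₚ.≤-total a b
... | inj₁ a≤b = subst (_≤ K) (sym (ℤₚ.∣⊖∣-≤ a≤b)) (ℕₚ.m≤n+o⇒m∸n≤o b a b≤)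
... | inj₂ b≤a = subst (_≤ K) (sym (trans (ℤₚ.∣m⊖n∣≡∣n⊖m∣ a b) (ℤₚ.∣⊖∣-≤ b≤a))) (ℕₚ.m≤n+o⇒m∸n≤o a b a≤)

-- Over the common denominator the difference has numerator at most `K`, so it is at most
-- `K / (suc t * suc m)`, which is below `1 / suc d`.
frequency-close : ∀ m c t K a d .(cop : Coprime (suc a) (suc d)) → suc m * c ≤ suc t + K → suc t ≤ suc m * c + K → K * suc d < suc t →
  ℚ.∣ (ℤ.+ c) ℚ./ suc t ℚ.- (ℤ.+ 1) ℚ./ suc m ∣ ℚ.< mkℚ (ℤ.+ suc a) d cop
frequency-close m c t K a d cop up lo big = ℚₚ.toℚᵘ-cancel-<
  (ℚᵘₚ.<-respˡ-≃ (ℚᵘₚ.≃-sym diff) (*<* cross))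
  where
  x y : ℚᵘ
  x = mkℚᵘ (ℤ.+ c) t
  y = mkℚᵘ (ℤ.+ 1) m
  diff : toℚᵘ ℚ.∣ fromℚᵘ x ℚ.- fromℚᵘ y ∣ ℚᵘ.≃ ℚᵘ.∣ x ℚᵘ.- y ∣
  diff = ℚᵘₚ.≃-trans (ℚₚ.toℚᵘ-homo-∣-∣ (fromℚᵘ x ℚ.- fromℚᵘ y)) (ℚᵘₚ.∣-∣-cong
    (ℚᵘₚ.≃-trans (ℚₚ.toℚᵘ-homo-+ (fromℚᵘ x) (ℚ.- fromℚᵘ y))
      (ℚᵘₚ.+-cong (ℚₚ.toℚᵘ-fromℚᵘ x)
        (ℚᵘₚ.≃-trans (ℚₚ.toℚᵘ-homo‿- (fromℚᵘ y)) (ℚᵘₚ.-‿cong (ℚₚ.toℚᵘ-fromℚᵘ y))))))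
  numerator : ℤ.∣ ℤ.+ c ℤ.* ℤ.+ suc m ℤ.+ ℤ.-[1+ 0 ] ℤ.* ℤ.+ suc t ∣ ≤ K
  numerator = subst (λ z → ℤ.∣ z ∣ ≤ K)
    (sym (trans (cong₂ ℤ._+_ (trans (sym (ℤₚ.pos-* c (suc m))) (cong ℤ.+_ (ℕₚ.*-comm c (suc m)))) (ℤₚ.-1*i≡-i (ℤ.+ suc t)))
      (ℤₚ.m-n≡m⊖n (suc m * c) (suc t))))
    (∣⊖∣≤ (suc m * c) (suc t) up lo)
  open ℕₚ.≤-Reasoning
  cross : ℤ.+ ℤ.∣ ℤ.+ c ℤ.* ℤ.+ suc m ℤ.+ ℤ.-[1+ 0 ] ℤ.* ℤ.+ suc t ∣ ℤ.* ℤ.+ suc d ℤ.< ℤ.+ suc a ℤ.* ℤ.+ (suc t * suc m)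
  cross = subst₂ ℤ._<_ (ℤₚ.pos-* ℤ.∣ ℤ.+ c ℤ.* ℤ.+ suc m ℤ.+ ℤ.-[1+ 0 ] ℤ.* ℤ.+ suc t ∣ (suc d)) (ℤₚ.pos-* (suc a) (suc t * suc m)) (ℤ.+<+ (begin-strict
    ℤ.∣ ℤ.+ c ℤ.* ℤ.+ suc m ℤ.+ ℤ.-[1+ 0 ] ℤ.* ℤ.+ suc t ∣ * suc d  ≤⟨ ℕₚ.*-monoˡ-≤ (suc d) numerator ⟩
    K * suc d                     <⟨ big ⟩
    suc t                         ≤⟨ ℕₚ.m≤m*n (suc t) (suc m) ⟩
    suc t * suc m                 ≤⟨ ℕₚ.m≤n*m (suc t * suc m) (suc a) ⟩
    suc a * (suc t * suc m)       ∎))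

periodic⇒balanced : ∀ {n m} (f : Assignment n (suc m)) h .{{_ : NonZero h}} → (∀ i t → f i (suc (t + h)) ≡ f i (suc t)) →
  (∀ i j → suc m * sumTo (λ r → ⟦ f i (suc r) ≟ j ⟧) h ≡ h) → Balanced f
periodic⇒balanced f h per exact i j (mkℚ (ℤ.+ zero) d cop) (ℚ.*<* (ℤ.+<+ ()))
periodic⇒balanced f h per exact i j (mkℚ ℤ.-[1+ a ] d cop) (ℚ.*<* ())
periodic⇒balanced {m = m} f h per exact i j (mkℚ (ℤ.+ suc a) d cop) _ =
  -- The error bound of `sumTo-bounds` times the denominator of ε; the outer `suc` makes the
  -- inequality strict.
  suc (suc m * h * suc d) , λ t big →
    let up , lo = bounds (suc t) in frequency-close m (count f i j (suc t)) t (suc m * h) a d cop up lo big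
  where
  bounds : ∀ t → suc m * count f i j t ≤ t + suc m * h × t ≤ suc m * count f i j t + suc m * h
  bounds t = subst (λ c → suc m * c ≤ t + suc m * h × t ≤ suc m * c + suc m * h) (sym (count≡sumTo f i j t))
    (sumTo-bounds (λ t → cong (λ k → ⟦ k ≟ j ⟧) (per i t)) {suc m} (λ t → ⟦⟧≤1 (f i (suc t) ≟ j)) (exact i j) t)

-- A zero count puts the frequency at distance exactly `1/q` from its limit, which balance with ε
-- equal to `1/q` excludes at time `suc N`.
balanced⇒performs : ∀ {n m} (f : Assignment n (suc m)) → Balanced f → ∀ i j → ∃[ r ] f i (suc r) ≡ j
balanced⇒performs {m = m} f bal i j = found (search (suc N))
  where
  1/q = (ℤ.+ 1) ℚ./ suc m
  0<1/q : 0ℚ ℚ.< 1/q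
  0<1/q = ℚₚ.positive⁻¹ 1/q {{ℚₚ.normalize-pos 1 (suc m)}}
  close = bal i j 1/q 0<1/q
  N = proj₁ close

  search : ∀ t → count f i j t ≡ 0 ⊎ (∃[ r ] f i (suc r) ≡ j)
  search zero    = inj₁ refl
  search (suc t) with search t
  ... | inj₂ hit = inj₂ hit
  ... | inj₁ eq with f i (suc t) ≟ j
  ...   | yes hit = inj₂ (t , hit)
  ...   | no  _   = inj₁ (trans (ℕₚ.+-identityʳ _) eq)

  found : count f i j (suc N) ≡ 0 ⊎ (∃[ r ] f i (suc r) ≡ j) → ∃[ r ] f i (suc r) ≡ j
  found (inj₂ hit) = hit
  found (inj₁ eq)  = contradiction (proj₂ close N (ℕₚ.n≤1+n N)) (ℚₚ.<-irrefl (begin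
    ℚ.∣ (ℤ.+ count f i j (suc N)) ℚ./ suc N ℚ.- 1/q ∣  ≡⟨ cong (λ c → ℚ.∣ (ℤ.+ c) ℚ./ suc N ℚ.- 1/q ∣) eq ⟩
    ℚ.∣ (ℤ.+ 0) ℚ./ suc N ℚ.- 1/q ∣                    ≡⟨ cong (λ x → ℚ.∣ x ℚ.- 1/q ∣) (ℚₚ.0/n≡0 (suc N)) ⟩
    ℚ.∣ 0ℚ ℚ.- 1/q ∣                                 ≡⟨ cong ℚ.∣_∣ (ℚₚ.+-identityˡ (ℚ.- 1/q)) ⟩
    ℚ.∣ ℚ.- 1/q ∣                                    ≡⟨ ℚₚ.∣-p∣≡∣p∣ 1/q ⟩
    ℚ.∣ 1/q ∣                                        ≡⟨ ℚₚ.0≤p⇒∣p∣≡p (ℚₚ.<⇒≤ 0<1/q) ⟩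
    1/q                                              ∎))
    where open ≡-Reasoning

-- Replaying weeks

-- After the other tasks are matched, a transposition corrects the image of `a Fin.zero`;
-- injectivity of `a` and `b` on `U` keeps it away from the values already fixed.
extend : ∀ {n q} {U : Fin n → Set} → (∀ i → Dec (U i)) → (a b : Fin n → Fin q) →
  (∀ {i k} → U i → U k → a i ≡ a k → i ≡ k) → (∀ {i k} → U i → U k → b i ≡ b k → i ≡ k) →
  ∃[ π ] (∀ i → U i → π ⟨$⟩ʳ a i ≡ b i)
extend {zero}  U? a b a-inj b-inj = idₚ , λ ()
extend {suc n} {q} {U} U? a b a-inj b-inj
  with extend {U = U ∘ Fin.suc} (U? ∘ Fin.suc) (a ∘ Fin.suc) (b ∘ Fin.suc)
         (λ u v eq → Finₚ.suc-injective (a-inj u v eq)) (λ u v eq → Finₚ.suc-injective (b-inj u v eq))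
     | U? Fin.zero
... | π , ok | no ¬u₀ = π , λ { Fin.zero u₀ → contradiction u₀ ¬u₀ ; (Fin.suc i) → ok i }
... | π , ok | yes u₀ = π ∘ₚ transpose (π ⟨$⟩ʳ a Fin.zero) (b Fin.zero) , ok′
  where
  0≢suc : ∀ {i : Fin n} → Fin.zero ≢ Fin.suc i
  0≢suc ()
  ok′ : ∀ i → U i → transpose (π ⟨$⟩ʳ a Fin.zero) (b Fin.zero) ⟨$⟩ʳ (π ⟨$⟩ʳ a i) ≡ b i
  ok′ Fin.zero    _ = transpose-i (π ⟨$⟩ʳ a Fin.zero) (b Fin.zero)
  ok′ (Fin.suc i) u = trans (transpose-k (π ⟨$⟩ʳ a Fin.zero) (b Fin.zero)
    (λ eq → 0≢suc (sym (a-inj u u₀ (perm-injective π eq))))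
    (λ eq → 0≢suc (sym (b-inj u u₀ (trans (sym (ok i u)) eq))))) (ok i u)

-- Two such tasks given to one worker would overlap at time `0ℚ`, since `s ≤ 0 < e` for both.
U-injective : ∀ {n q} {I : Intervals n} (𝒮 : ScheduleSet I) (f : Assignment n q) → Feasible 𝒮 f →
  ∀ r {i k} → InU I i → InU I k → f i (suc r) ≡ f k (suc r) → i ≡ k
U-injective {I = I} 𝒮 f feas r {i} {k} ui uk eq with i ≟ k
... | yes i≡k = i≡k
... | no  i≢k = contradiction ((ui , e-pos I i) , (uk , e-pos I k))
  (proj₁ (proj₂ (schedule 𝒮 _ (feas (f k (suc r)) (suc r) (s≤s z≤n))) i (mem i eq)) k (mem k refl) (i≢k ∘ sym) 0ℚ)
  where
  on : ∀ {j} (d : Dec (j ≡ f k (suc r))) → j ≡ f k (suc r) → (if ⌊ d ⌋ then inside else outside) ≡ inside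
  on (yes _) _ = refl
  on (no ¬p) p = contradiction p ¬p
  mem : ∀ i → f i (suc r) ≡ f k (suc r) → i ∈ proj₁ (induced I f (f k (suc r)) (suc r))
  mem i eq = lookup⇒[]= i _ (trans (lookup∘tabulate _ i) (on (f i (suc r) ≟ f k (suc r)) eq))

-- Only tasks with `InU` enter the second component, so the following week has to match on these
-- alone.
induced-≡ : ∀ {n q} (I : Intervals n) (f g : Assignment n q) {j k r t} →
  (∀ i → (f i r ≡ j → g i t ≡ k) × (g i t ≡ k → f i r ≡ j)) →
  (∀ i → InU I i → (f i (suc r) ≡ j → g i (suc t) ≡ k) × (g i (suc t) ≡ k → f i (suc r) ≡ j)) →
  induced I f j r ≡ induced I g k t
induced-≡ I f g {j} {k} {r} {t} T W = cong₂ _,_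
  (tabulate-cong λ i → if-cong (proj₁ (T i)) (proj₂ (T i)) (f i r ≟ j) (g i t ≟ k)) (tabulate-cong waiting)
  where
  waiting : ∀ i →
    (if ⌊ s I i ℚ.≤? 0ℚ ⌋ then (if ⌊ f i (suc r) ≟ j ⌋ then inside else outside) else outside) ≡
    (if ⌊ s I i ℚ.≤? 0ℚ ⌋ then (if ⌊ g i (suc t) ≟ k ⌋ then inside else outside) else outside)
  waiting i with s I i ℚ.≤? 0ℚ
  ... | yes u = if-cong (proj₁ (W i u)) (proj₂ (W i u)) (f i (suc r) ≟ j) (g i (suc t) ≟ k)
  ... | no  _ = refl

≤-sum : ∀ {n} (g : Fin n → ℕ) i → g i ≤ sum g
≤-sum g Fin.zero    = ℕₚ.m≤m+n _ _
≤-sum g (Fin.suc i) = ℕₚ.≤-trans (≤-sum (g ∘ Fin.suc) i) (ℕₚ.m≤n+m _ _)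

-- Week r ≥ 1 of the assignments has index r − 1 here, so x 0 belongs to week 1.
module _ {n m} {I : Intervals n} (𝒮 : ScheduleSet I) (f : Assignment n (suc m)) (feas : Feasible 𝒮 f)
  (x : ℕ → Permutation′ (suc m)) (ι : Fin n → Fin (suc m))
  (aligned : ∀ r i → InU I i → x r ⟨$⟩ʳ f i (suc r) ≡ ι i)
  (p₀ : Fin (suc m)) (meet : ∀ j → ∃[ r ] x r ⟨$⟩ʳ j ≡ p₀) where

  private
    q = suc m

    -- Runs backwards in time, from a worker's position in the next week to the one in week `r`,
    -- because states act on the positions they receive.
    shift : ℕ → Permutation′ q
    shift r = flip (x (suc r)) ∘ₚ x r

    shift-x : ∀ r j → shift r ⟨$⟩ʳ (x (suc r) ⟨$⟩ʳ j) ≡ x r ⟨$⟩ʳ j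
    shift-x r j = cong (x r ⟨$⟩ʳ_) (inverseˡ (x (suc r)))

    -- A week before R that moves p to p′, if there is one (junk value 0 otherwise).
    choose : ℕ → Fin q → Fin q → ℕ
    choose zero    p p′ = 0
    choose (suc R) p p′ with shift R ⟨$⟩ʳ p ≟ p′
    ... | yes _ = R
    ... | no  _ = choose R p p′

    -- The chosen week may differ from `r`; agreement of the two shifts at `p` is all that
    -- connectivity requires.
    choose-hits : ∀ R {r} → r < R → ∀ p → shift (choose R p (shift r ⟨$⟩ʳ p)) ⟨$⟩ʳ p ≡ shift r ⟨$⟩ʳ p
    choose-hits (suc R) {r} r<1+R p with shift R ⟨$⟩ʳ p ≟ shift r ⟨$⟩ʳ p
    ... | yes eq = eq
    ... | no neq = choose-hits R (ℕₚ.≤∧≢⇒< (ℕₚ.≤-pred r<1+R) λ { refl → neq refl }) p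

    -- A sum as an easy upper bound for the finitely many meeting weeks.
    R : ℕ
    R = sum (proj₁ ∘ meet)

    -- One label per pair of positions keeps the number of labels independent of `R`. The junk value
    -- is still a genuine week, hence safe to replay.
    week : Fin (q * q) → ℕ
    week l = choose R (proj₁ (remQuot {q} q l)) (proj₂ (remQuot {q} q l))

    ρ : Fin (q * q) → Permutation′ q
    ρ = shift ∘ week

    _~_ : Fin q → Fin q → Set
    _~_ = EqClosure (λ a b → ∃[ l ] ρ l ⟨$⟩ʳ a ≡ b)

    x~ : ∀ {r} → r < R → ∀ j → (x (suc r) ⟨$⟩ʳ j) ~ (x r ⟨$⟩ʳ j)
    x~ {r} r<R j = Eq.return (combine p (shift r ⟨$⟩ʳ p) ,
      trans (cong (λ pp → shift (choose R (proj₁ pp) (proj₂ pp)) ⟨$⟩ʳ p) (remQuot-combine p (shift r ⟨$⟩ʳ p)))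
        (trans (choose-hits R r<R p) (shift-x r j)))
      where p = x (suc r) ⟨$⟩ʳ j

    x~x₀ : ∀ {r} → r ≤ R → ∀ j → (x r ⟨$⟩ʳ j) ~ (x 0 ⟨$⟩ʳ j)
    x~x₀ {zero}  _   j = Eq.reflexive _
    x~x₀ {suc r} r<R j = Eq.transitive _ (x~ r<R j) (x~x₀ (ℕₚ.<⇒≤ r<R) j)

    -- The worker at `p` in week index 0 reaches `p₀` by week `R`, and all positions it takes on the
    -- way are connected.
    ~p₀ : ∀ p → p₀ ~ p
    ~p₀ p = subst₂ _~_ (proj₂ (meet j)) (inverseʳ (x 0)) (x~x₀ (≤-sum (proj₁ ∘ meet) j) j)
      where j = x 0 ⟨$⟩ˡ p

    open UniformWalk (uniformWalk ρ λ p p′ → Eq.transitive _ (Eq.symmetric _ (~p₀ p)) (~p₀ p′))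

    pos : Fin n → Fin (q * q) → Fin q
    pos i l = x (week l) ⟨$⟩ʳ f i (suc (week l))

    -- Week `suc t` uses step `t` of the walk, hence `pred`.
    g : Assignment n q
    g i r = state (pred r) ⟨$⟩ʳ pos i (label (pred r))

    g-feasible : Feasible 𝒮 g
    g-feasible j (suc t) _ = subst (S 𝒮) (sym (induced-≡ I g f T W)) (feas j₀ (suc w) (s≤s z≤n))
      where
      w = week (label t)
      π : Permutation′ q
      π = x w ∘ₚ state t
      j₀ = π ⟨$⟩ˡ j

      iff : ∀ {a b} → b ≡ π ⟨$⟩ʳ a → (b ≡ j → a ≡ j₀) × (a ≡ j₀ → b ≡ j)
      iff refl = (λ eq → trans (sym (inverseˡ π)) (cong (π ⟨$⟩ˡ_) eq)) ,
                 (λ eq → trans (cong (π ⟨$⟩ʳ_) eq) (inverseʳ π))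

      T : ∀ i → (g i (suc t) ≡ j → f i (suc w) ≡ j₀) × (f i (suc w) ≡ j₀ → g i (suc t) ≡ j)
      T i = iff refl

      open ≡-Reasoning
      W : ∀ i → InU I i → (g i (suc (suc t)) ≡ j → f i (suc (suc w)) ≡ j₀) × (f i (suc (suc w)) ≡ j₀ → g i (suc (suc t)) ≡ j)
      -- The next week of `g` may replay any week, yet there, as in week index `suc w`, this task
      -- sits at position `ι i`.
      W i u = iff (begin
        state (suc t) ⟨$⟩ʳ pos i (label (suc t))                        ≡⟨ cong (state (suc t) ⟨$⟩ʳ_) (aligned _ i u) ⟩
        state (suc t) ⟨$⟩ʳ ι i                                          ≡⟨ cong (state (suc t) ⟨$⟩ʳ_) (aligned (suc w) i u) ⟨
        state (suc t) ⟨$⟩ʳ (x (suc w) ⟨$⟩ʳ f i (suc (suc w)))           ≡⟨ state-suc t _ ⟩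
        state t ⟨$⟩ʳ (shift w ⟨$⟩ʳ (x (suc w) ⟨$⟩ʳ f i (suc (suc w))))  ≡⟨ cong (state t ⟨$⟩ʳ_) (shift-x w _) ⟩
        π ⟨$⟩ʳ f i (suc (suc w))                                        ∎)

    g-per : ∀ i t → g i (suc (t + h)) ≡ g i (suc t)
    g-per i t = cong₂ (λ π l → π ⟨$⟩ʳ pos i l) (state-per t) (label-per t)

  periodicAssignment : ∃[ f ] ∃[ h ] (1 ≤ h × h ≤ q ^ 2 * q ! × Periodic f h × Feasible 𝒮 f × Balanced f)
  periodicAssignment = g , h , h≥1 ,
    subst (λ k → h ≤ k * q !) (cong (q *_) (sym (ℕₚ.*-identityʳ q))) h≤ ,
    (λ { i (suc t) _ → sym (g-per i t) }) , g-feasible ,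
    periodic⇒balanced g h {{ℕ.>-nonZero h≥1}} g-per (λ i → uniform (pos i))

-- Choice of the bijections, with and without tasks starting by time 0

theorem1p3 : ∀ {n : ℕ} (I : Intervals n) (q : ℕ) .{{_ : NonZero q}} (𝒮 : ScheduleSet I) →
    (∃[ f ] (Feasible 𝒮 f × Balanced f)) →
    ∃[ f ] ∃[ h ] (1 ≤ h × h ≤ q ^ 2 * q ! × Periodic f h × Feasible 𝒮 f × Balanced f)
theorem1p3 I zero 𝒮 _ = contradiction refl (ℕ.≢-nonZero⁻¹ 0)
theorem1p3 I (suc m) 𝒮 (f , feas , bal) with any? (λ i → s I i ℚ.≤? 0ℚ)
-- Positions are named after the workers of the first week. By balance every worker performs `i₀` at
-- some time and is then at position `f i₀ 1`.
... | yes (i₀ , u₀) = periodicAssignment 𝒮 f feas (proj₁ ∘ align) (λ i → f i 1) (proj₂ ∘ align) (f i₀ 1) meet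
  where
  align : ∀ r → ∃[ π ] (∀ i → InU I i → π ⟨$⟩ʳ f i (suc r) ≡ f i 1)
  align r = extend (λ i → s I i ℚ.≤? 0ℚ) (λ i → f i (suc r)) (λ i → f i 1) (U-injective 𝒮 f feas r) (U-injective 𝒮 f feas 0)

  meet : ∀ j → ∃[ r ] proj₁ (align r) ⟨$⟩ʳ j ≡ f i₀ 1
  meet j with balanced⇒performs f bal i₀ j
  ... | r , refl = r , proj₂ (align r) i₀ u₀
-- Alignment is vacuous here; the transposition brings worker `j` to position zero in the week of
-- index `toℕ j`.
... | no noU = periodicAssignment 𝒮 f feas (λ r → transpose Fin.zero (r mod suc m)) (λ i → f i 1)
  (λ r i u → contradiction (i , u) noU) Fin.zero
  (λ j → toℕ j , trans (cong (λ k → transpose Fin.zero k ⟨$⟩ʳ j) (toℕ-mod j)) (transpose-j Fin.zero j))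
  where
  toℕ-mod : ∀ j → toℕ j mod suc m ≡ j
  toℕ-mod j = Finₚ.toℕ-injective (trans (Finₚ.toℕ-fromℕ< _) (m<n⇒m%n≡m (Finₚ.toℕ<n j)))
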